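{- Let $G=(V,E)$ be a finite simple graph on $n\geq 1$ vertices. Then $F(G)\geq \left\lfloor \frac{n-1}{2}\right\rfloor$.
   Context: Zero forcing: given a graph $G=(V,E)$ and a set $S\subseteq V$ of "filled" vertices, the color change rule says that if a filled vertex $v$ has exactly one unfilled neighbor $w$, then $w$ becomes filled. The derived set of $S$ is the set of filled vertices obtained after applying this rule until no further application is possible. $S$ is a zero forcing set if its derived set is $V$; otherwise $S$ is a failed zero forcing set. The failed zero forcing number $F(G)$ is the maximum size of a failed zero forcing set of $G$. -}

module Defs where

open import Level using (0ℓ)
open import Data.Nat using (ℕ; suc; _∸_; _/_; _≤_)
open import Data.Fin using (Fin)
open import Data.Fin.Subset using (Subset; _∈_; ∣_∣)
open import Data.Product using (Σ; ∃; _×_)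
open import Relation.Nullary using (¬_; Dec)
open import Relation.Binary.PropositionalEquality using (_≡_)

record Graph (n : ℕ) : Set₁ where
  field
    Adj   : Fin n → Fin n → Set
    adj?  : (u v : Fin n) → Dec (Adj u v)
    sym   : ∀ {u v} → Adj u v → Adj v u
    irrefl : ∀ {u} → ¬ Adj u u

open Graph public

-- The derived set of S: the least set containing S and closed under the
-- color change rule. Vertex v gets filled from a filled u when v is a
-- neighbour of u and every other neighbour of u is already filled
-- (i.e. v is the only possibly-unfilled neighbour of u).
data Derived {n : ℕ} (G : Graph n) (S : Subset n) : Fin n → Set where
  initial : ∀ {v} → v ∈ S → Derived G S v
  force   : ∀ {u v} → Derived G S u → Adj G u v →
            (∀ w → Adj G u w → ¬ (w ≡ v) → Derived G S w) →
            Derived G S v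

FailedZFS : {n : ℕ} → Graph n → Subset n → Set
FailedZFS G S = ∃ λ v → ¬ Derived G S v

-- k ≤ F(G): there is a failed zero forcing set of size at least k.
-- (F(G) is the maximum size of a failed zero forcing set.)
_≤F_ : {n : ℕ} → ℕ → Graph n → Set
k ≤F G = Σ _ λ S → FailedZFS G S × k ≤ ∣ S ∣

{-# OPTIONS --safe #-}

-- A fort is a nonempty vertex set W such that no vertex outside W has exactly
-- one neighbour in W; the complement of a fort is a failed zero forcing set.
-- So it suffices to find a fort W with 2|W| ≤ n + 2.  This is proved for
-- multigraphs (edges counted with multiplicity) by induction on n in steps of
-- two.  An isolated vertex is a fort.  If v has a single neighbour a, delete v
-- and a, and add v to a fort of the rest exactly when a would otherwise see one
-- vertex of it.  If v has degree two with distinct neighbours a and b, merge v,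
-- a and b into one vertex.  If all degrees are at least three, every vertex has
-- at least two edges across a maximum cut, so both sides of the cut are forts.
module Submission where

open import Defs
open import Data.Bool using (Bool; true; false; not; _∨_; _xor_; if_then_else_)
open import Data.Bool.Properties using (xor-comm; xor-annihilates-not; ¬-not)
open import Data.Fin using (Fin; zero; suc; punchIn)
open import Data.Fin.Patterns using (0F; 1F; 2F)
open import Data.Fin.Permutation
  using (Permutation′; _⟨$⟩ʳ_; _⟨$⟩ˡ_; inverseˡ; inverseʳ; transpose; lift₀)
open import Data.Fin.Properties using (any?; punchInᵢ≢i)
open import Data.Fin.Subset using (∣_∣)
open import Data.Nat using (ℕ; zero; suc; _+_; _*_; _∸_; _/_; _≤_; pred; z≤n; s≤s; s≤s⁻¹; _≟_; _≤?_)
open import Data.Nat.DivMod using (m<n*o⇒m/o<n)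
open import Data.Nat.Properties
  using (≤-refl; ≤-reflexive; ≤-trans; ≤-total; +-mono-≤; +-monoˡ-≤; +-monoʳ-≤; +-cancelʳ-≤;
         m≤m+n; m≤n+m; n≤0⇒n≡0; ≰⇒>; +-assoc; +-comm; +-suc; +-identityʳ;
         m+n≡0⇒n≡0; <⇒≤; <-irrefl; +-0-commutativeMonoid; module ≤-Reasoning)
open import Algebra.Properties.CommutativeMonoid.Sum +-0-commutativeMonoid
  using (sum; sum-cong-≗; sum-remove; sum-permute; sum-replicate-zero; ∑-distrib-+)
open import Data.Nat.Tactic.RingSolver using (solve-∀)
open import Data.Product using (_×_; _,_; ∃)
open import Data.Sum using (_⊎_; inj₁; inj₂)
open import Data.Vec using (tabulate)
open import Data.Vec.Functional using (_∷_; head; tail; insertAt; removeAt)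
open import Data.Vec.Functional.Properties using (insertAt-lookup; insertAt-punchIn)
open import Data.Vec.Properties using ([]=⇒lookup; lookup∘tabulate)
open import Function using (_∘_)
open import Relation.Binary.PropositionalEquality
  using (_≡_; _≢_; _≗_; refl; trans; cong; cong₂; subst; subst₂; module ≡-Reasoning)
  renaming (sym to ≡-sym)
open import Relation.Nullary using (Dec; does; yes; no; ¬?; contradiction; decidable-stable)
open import Relation.Nullary.Decidable using (dec-true)

-- Filtered sums of natural numbers.

infixl 7 _when_

_when_ : ℕ → Bool → ℕ
x when b = if b then x else 0

0-when : ∀ b → 0 when b ≡ 0
0-when false = refl
0-when true  = refl

when-≤ : ∀ x b → x when b ≤ x
when-≤ x false = z≤n
when-≤ x true  = ≤-refl

when-+ : ∀ x y b → (x + y) when b ≡ x when b + y when b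
when-+ x y false = refl
when-+ x y true  = refl

when-xor-not : ∀ x b c → x when (b xor c) + x when (not b xor c) ≡ x
when-xor-not x false false = refl
when-xor-not x false true  = +-identityʳ x
when-xor-not x true  false = +-identityʳ x
when-xor-not x true  true  = refl

term≤sum : ∀ {n} (f : Fin n → ℕ) i → f i ≤ sum f
term≤sum f zero    = m≤m+n (f zero) _
term≤sum f (suc i) = ≤-trans (term≤sum (f ∘ suc) i) (m≤n+m _ (f zero))

sum-zero : ∀ {n} {f : Fin n → ℕ} → (∀ i → f i ≡ 0) → sum f ≡ 0
sum-zero {n} f≡0 = trans (sum-cong-≗ f≡0) (sum-replicate-zero n)

sum≢0⇒∃ : ∀ {n} (f : Fin n → ℕ) → sum f ≢ 0 → ∃ λ i → f i ≢ 0
sum≢0⇒∃ f sum≢0 with any? (λ i → ¬? (f i ≟ 0))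
... | yes p = p
... | no ¬p = contradiction
  (sum-zero λ i → decidable-stable (f i ≟ 0) λ fi≢0 → ¬p (i , fi≢0)) sum≢0

-- The usual way to check the fort condition: edges into the fort that come from two separate
-- sources number at least two.
+-≢0⇒≢1 : ∀ {a b} → a ≢ 0 → b ≢ 0 → a + b ≢ 1
+-≢0⇒≢1 {zero}          a≢0 b≢0 = contradiction refl a≢0
+-≢0⇒≢1 {suc a} {zero}  a≢0 b≢0 = contradiction refl b≢0
+-≢0⇒≢1 {suc a} {suc b} a≢0 b≢0 eq with m+n≡0⇒n≡0 a (cong pred eq)
... | ()

-- Multigraphs and forts.

record Multigraph (n : ℕ) : Set where
  field
    mult      : Fin n → Fin n → ℕ
    symmetric : ∀ u v → mult u v ≡ mult v u
    loopless  : ∀ v → mult v v ≡ 0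

open Multigraph

size : ∀ {n} → (Fin n → Bool) → ℕ
size W = sum (λ v → 1 when W v)

-- Counts edges, not neighbours: a vertex outside a fort may see it through one double edge alone.
-- Contraction relies on this, since merging two neighbours of a vertex creates parallel edges.
edgesInto : ∀ {n} → Multigraph n → (Fin n → Bool) → Fin n → ℕ
edgesInto G W v = sum (λ w → mult G v w when W w)

degree : ∀ {n} → Multigraph n → Fin n → ℕ
degree G v = sum (mult G v)

Fort : ∀ {n} → Multigraph n → (Fin n → Bool) → Set
Fort G W = (∃ λ v → W v ≡ true) × (∀ v → W v ≡ false → edgesInto G W v ≢ 1)

SmallFort : ∀ {n} → Multigraph n → Set
SmallFort {n} G = ∃ λ W → Fort G W × size W + size W ≤ 2 + n

edgesInto-cong : ∀ {n} (G : Multigraph n) {W W′} → W ≗ W′ → edgesInto G W ≗ edgesInto G W′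
edgesInto-cong G W≗W′ v = sum-cong-≗ λ w → cong (mult G v w when_) (W≗W′ w)

size-cong : ∀ {n} {W W′ : Fin n → Bool} → W ≗ W′ → size W ≡ size W′
size-cong W≗W′ = sum-cong-≗ λ v → cong (1 when_) (W≗W′ v)

-- Relabelling vertices.

relabel : ∀ {n} → Multigraph n → Permutation′ n → Multigraph n
relabel G π = record
  { mult      = λ u v → mult G (π ⟨$⟩ʳ u) (π ⟨$⟩ʳ v)
  ; symmetric = λ u v → symmetric G (π ⟨$⟩ʳ u) (π ⟨$⟩ʳ v)
  ; loopless  = λ v → loopless G (π ⟨$⟩ʳ v)
  }

degree-relabel : ∀ {n} (G : Multigraph n) π v → degree (relabel G π) v ≡ degree G (π ⟨$⟩ʳ v)
degree-relabel G π v = ≡-sym (sum-permute (mult G (π ⟨$⟩ʳ v)) π)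

-- Lets the reductions be stated at the fixed positions `0F`, `1F` and `2F`: a transposition brings
-- the chosen vertices there, and the fort is carried back along its inverse.
relabel-smallFort : ∀ {n} (G : Multigraph n) π → SmallFort (relabel G π) → SmallFort G
relabel-smallFort {n} G π (W , ((v , Wv) , fort) , small) =
  W′ , ((π ⟨$⟩ʳ v , trans (cong W (inverseˡ π)) Wv) , fort′) ,
  subst (λ s → s + s ≤ 2 + n) (≡-sym size≡) small
  where
  W′ : Fin n → Bool
  W′ u = W (π ⟨$⟩ˡ u)

  size≡ : size W′ ≡ size W
  size≡ = trans (sum-permute (λ u → 1 when W′ u) π) (size-cong {W′ = W} λ u → cong W (inverseˡ π {u}))

  edgesInto≡ : ∀ u → edgesInto G W′ u ≡ edgesInto (relabel G π) W (π ⟨$⟩ˡ u)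
  edgesInto≡ u = trans (sum-permute (λ w → mult G u w when W′ w) π)
    (sum-cong-≗ λ w → cong₂ (λ x y → mult G x (π ⟨$⟩ʳ w) when W y)
      (≡-sym (inverseʳ π)) (inverseˡ π))

  fort′ : ∀ u → W′ u ≡ false → edgesInto G W′ u ≢ 1
  fort′ u W′u eq = fort (π ⟨$⟩ˡ u) W′u (trans (≡-sym (edgesInto≡ u)) eq)

-- Tiny graphs and reductions at a vertex with at most two neighbours.

isolated-smallFort : ∀ {n} (G : Multigraph (suc n)) → (∀ j → mult G 0F (suc j) ≡ 0) → SmallFort G
isolated-smallFort {n} G isolated =
  (true ∷ λ _ → false) , ((0F , refl) , fort) ,
  subst (λ s → suc s + suc s ≤ 3 + n) (≡-sym (sum-replicate-zero n)) (s≤s (s≤s z≤n))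
  where
  fort : ∀ v → (true ∷ λ _ → false) v ≡ false → edgesInto G (true ∷ λ _ → false) v ≢ 1
  fort (suc i) _ eq with trans (≡-sym eq)
    (cong₂ _+_ (trans (symmetric G (suc i) 0F) (isolated i)) (sum-replicate-zero n))
  ... | ()

-- No vertex lies outside, so the fort condition is vacuous. This supplies the base cases of one and
-- two vertices.
full-smallFort : ∀ {n} (G : Multigraph (suc n)) → suc n ≤ 2 → SmallFort G
full-smallFort {n} G n≤2 =
  (λ _ → true) , ((0F , refl) , λ _ ()) ,
  subst (λ s → s + s ≤ 3 + n) (≡-sym (sum-ones (suc n))) (+-monoˡ-≤ (suc n) n≤2)
  where
  sum-ones : ∀ k → size {k} (λ _ → true) ≡ k
  sum-ones zero    = refl
  sum-ones (suc k) = cong suc (sum-ones k)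

-- Why the induction goes in steps of two: two more vertices in the graph pay for one more vertex in
-- the fort.
small-step : ∀ {s t n} → t ≤ suc s → s + s ≤ 2 + n → t + t ≤ 4 + n
small-step {s} {t} {n} t≤1+s small = begin
  t + t           ≤⟨ +-mono-≤ t≤1+s t≤1+s ⟩
  suc s + suc s   ≡⟨ cong suc (+-suc s s) ⟩
  2 + (s + s)     ≤⟨ s≤s (s≤s small) ⟩
  4 + n           ∎
  where open ≤-Reasoning

delete₂ : ∀ {n} → Multigraph (2 + n) → Multigraph n
delete₂ G = record
  { mult      = λ u v → mult G (suc (suc u)) (suc (suc v))
  ; symmetric = λ u v → symmetric G (suc (suc u)) (suc (suc v))
  ; loopless  = λ v → loopless G (suc (suc v))
  }

-- Only `1F` can be spoiled by extending `V`, since it stays outside and sees `s` edges into `V`.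
-- Adding `0F` exactly when `s` is 1 gives it a second edge, and no vertex other than `1F` notices
-- `0F`.
pendant-smallFort : ∀ {n} (G : Multigraph (2 + n)) →
  mult G 0F 1F ≢ 0 → (∀ j → mult G 0F (suc (suc j)) ≡ 0) →
  SmallFort (delete₂ G) → SmallFort G
pendant-smallFort {n} G m₀₁≢0 m₀ⱼ≡0 (V , ((v , Vv) , fort) , small) =
  extend (s ≟ 1)
  where
  s : ℕ
  s = sum (λ j → mult G 1F (suc (suc j)) when V j)

  fort′ : (s≟1 : Dec (s ≡ 1)) → let W = does s≟1 ∷ false ∷ V in
          ∀ u → W u ≡ false → edgesInto G W u ≢ 1
  -- When `0F` is left out, its sole neighbour `1F` is out as well, so it sees nothing.
  fort′ s≟1 0F Wu eq rewrite Wu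
    with trans (≡-sym eq)
      (sum-zero λ j → trans (cong (_when V j) (m₀ⱼ≡0 j)) (0-when (V j)))
  ... | ()
  fort′ (yes s≡1) 1F _ = +-≢0⇒≢1 (λ m₁₀≡0 → m₀₁≢0 (trans (symmetric G _ _) m₁₀≡0))
    λ s≡0 → contradiction (trans (≡-sym s≡1) s≡0) λ ()
  fort′ (no s≢1) 1F _ = s≢1
  fort′ s≟1 (suc (suc i)) Vi eq = fort i Vi (trans
    (≡-sym (cong (_+ edgesInto (delete₂ G) V i)
      (trans (cong (_when does s≟1) (trans (symmetric G _ _) (m₀ⱼ≡0 i))) (0-when (does s≟1)))))
    eq)

  extend : Dec (s ≡ 1) → SmallFort G
  extend s≟1 =
    (does s≟1 ∷ false ∷ V) , ((suc (suc v) , Vv) , fort′ s≟1) ,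
    small-step {size V} (+-monoˡ-≤ (size V) (when-≤ 1 (does s≟1))) small

-- Vertex `0F` of the result stands for `0F`, `1F` and `2F` together. Edges among these three are
-- dropped to avoid loops, and the edges of `1F` and `2F` to any other vertex add up.
contract : ∀ {n} → Multigraph (3 + n) → Multigraph (suc n)
contract {n} G = record { mult = m ; symmetric = m-sym ; loopless = m-loopless }
  where
  m : Fin (suc n) → Fin (suc n) → ℕ
  m zero    zero    = 0
  m zero    (suc j) = mult G 1F (suc (suc (suc j))) + mult G 2F (suc (suc (suc j)))
  m (suc i) zero    = mult G (suc (suc (suc i))) 1F + mult G (suc (suc (suc i))) 2F
  m (suc i) (suc j) = mult G (suc (suc (suc i))) (suc (suc (suc j)))

  m-sym : ∀ u v → m u v ≡ m v u
  m-sym zero    zero    = refl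
  m-sym zero    (suc j) = cong₂ _+_ (symmetric G _ _) (symmetric G _ _)
  m-sym (suc i) zero    = cong₂ _+_ (symmetric G _ _) (symmetric G _ _)
  m-sym (suc i) (suc j) = symmetric G _ _

  m-loopless : ∀ v → m v v ≡ 0
  m-loopless zero    = refl
  m-loopless (suc i) = loopless G _

module _ {n} (G : Multigraph (3 + n))
  (m₀₁≢0 : mult G 0F 1F ≢ 0) (m₀₂≢0 : mult G 0F 2F ≢ 0)
  (m₀ⱼ≡0 : ∀ j → mult G 0F (suc (suc (suc j))) ≡ 0) where

  private
    H = contract G

  -- The merged vertex is replaced by both `1F` and `2F`. All other vertices see the same number of
  -- edges as before, and `0F`, left outside, sees both of its neighbours.
  merged∈-fort : ∀ V → Fort H (true ∷ V) → Fort G (false ∷ true ∷ true ∷ V)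
  merged∈-fort V (_ , fort) = (1F , refl) , fort′
    where
    fort′ : ∀ u → (false ∷ true ∷ true ∷ V) u ≡ false →
            edgesInto G (false ∷ true ∷ true ∷ V) u ≢ 1
    fort′ 0F _ = +-≢0⇒≢1 m₀₁≢0 (λ eq → m₀₂≢0 (n≤0⇒n≡0 (≤-trans (m≤m+n _ _) (≤-reflexive eq))))
    fort′ 1F ()
    fort′ 2F ()
    fort′ (suc (suc (suc i))) Vi eq =
      fort (suc i) Vi (trans (+-assoc (mult G (suc (suc (suc i))) 1F) _ _) eq)

  -- The fort condition at the merged vertex says `s₁ + s₂` is not 1. So if one of the two sums is
  -- 1, the other is nonzero, and adding `0F` gives both `1F` and `2F` at least two edges. If
  -- neither is 1, `V` can be kept as it is.
  merged∉-fort : ∀ V → Fort H (false ∷ V) → ∃ λ t → Fort G (t ∷ false ∷ false ∷ V)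
  merged∉-fort V ((zero , ()) , _)
  merged∉-fort V ((suc v , Vv) , fort) =
    _ , (suc (suc (suc v)) , Vv) , fort′ (s₁ ≟ 1) (s₂ ≟ 1)
    where
    s₁ s₂ : ℕ
    s₁ = sum (λ j → mult G 1F (suc (suc (suc j))) when V j)
    s₂ = sum (λ j → mult G 2F (suc (suc (suc j))) when V j)

    s₁+s₂≢1 : s₁ + s₂ ≢ 1
    s₁+s₂≢1 eq = fort 0F refl (trans
      (sum-cong-≗ λ j → when-+ (mult G 1F (suc (suc (suc j)))) _ (V j))
      (trans (∑-distrib-+ (λ j → mult G 1F (suc (suc (suc j))) when V j) _) eq))

    m₁₀≢0 : mult G 1F 0F ≢ 0
    m₁₀≢0 eq = m₀₁≢0 (trans (symmetric G _ _) eq)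

    m₂₀≢0 : mult G 2F 0F ≢ 0
    m₂₀≢0 eq = m₀₂≢0 (trans (symmetric G _ _) eq)

    fort′ : (d₁ : Dec (s₁ ≡ 1)) (d₂ : Dec (s₂ ≡ 1)) →
            let W = (does d₁ ∨ does d₂) ∷ false ∷ false ∷ V in
            ∀ u → W u ≡ false → edgesInto G W u ≢ 1
    fort′ d₁ d₂ 0F Wu eq rewrite Wu
      with trans (≡-sym eq)
        (sum-zero λ j → trans (cong (_when V j) (m₀ⱼ≡0 j)) (0-when (V j)))
    ... | ()
    fort′ (yes s₁≡1) _ 1F _ =
      +-≢0⇒≢1 m₁₀≢0 λ s₁≡0 → contradiction (trans (≡-sym s₁≡1) s₁≡0) λ ()
    fort′ (no _) (yes s₂≡1) 1F _ =
      +-≢0⇒≢1 m₁₀≢0 λ s₁≡0 → s₁+s₂≢1 (cong₂ _+_ s₁≡0 s₂≡1)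
    fort′ (no s₁≢1) (no _) 1F _ = s₁≢1
    fort′ (yes s₁≡1) _ 2F _ =
      +-≢0⇒≢1 m₂₀≢0 λ s₂≡0 → s₁+s₂≢1 (cong₂ _+_ s₁≡1 s₂≡0)
    fort′ (no _) (yes s₂≡1) 2F _ =
      +-≢0⇒≢1 m₂₀≢0 λ s₂≡0 → contradiction (trans (≡-sym s₂≡1) s₂≡0) λ ()
    fort′ (no _) (no s₂≢1) 2F _ = s₂≢1
    fort′ d₁ d₂ (suc (suc (suc i))) Vi eq = fort (suc i) Vi (trans
      (≡-sym (cong (_+ edgesInto H (false ∷ V) (suc i))
        (trans (cong (_when t) (trans (symmetric G _ _) (m₀ⱼ≡0 i))) (0-when t))))
      eq)
      where
      t : Bool
      t = does d₁ ∨ does d₂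

  contract-smallFort : SmallFort H → SmallFort G
  contract-smallFort (V′ , ((v , V′v) , fort) , small) =
    extend (head V′) (tail V′)
      ((v , trans (≡-sym (η v)) V′v) ,
       λ u Vu eq → fort u (trans (η u) Vu) (trans (edgesInto-cong H η u) eq))
      (subst (λ s → s + s ≤ 3 + n) (size-cong η) small)
    where
    η : V′ ≗ head V′ ∷ tail V′
    η zero    = refl
    η (suc i) = refl

    extend : ∀ c V → Fort H (c ∷ V) → size (c ∷ V) + size (c ∷ V) ≤ 3 + n → SmallFort G
    extend true  V fortV smallV =
      _ , merged∈-fort V fortV , small-step {suc (size V)} ≤-refl smallV
    extend false V fortV smallV with merged∉-fort V fortV
    ... | t , fortW = _ , fortW , small-step {size V} (+-monoˡ-≤ (size V) (when-≤ 1 t)) smallV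

-- Choosing the reduction at a vertex of degree at most two.

module _ {n} (ih : (H : Multigraph (suc n)) → SmallFort H) where

  adjacent-smallFort : (G : Multigraph (3 + n)) → degree G 0F ≤ 2 → mult G 0F 1F ≢ 0 → SmallFort G
  adjacent-smallFort G deg≤2 m₀₁≢0 with any? (λ j → ¬? (mult G 0F (suc (suc j)) ≟ 0))
  -- The only neighbour is `1F`, possibly through a double edge; the pendant reduction covers both
  -- multiplicities.
  ... | no ¬p = pendant-smallFort G m₀₁≢0
        (λ j → decidable-stable (_ ≟ 0) λ m≢0 → ¬p (j , m≢0)) (ih (delete₂ G))
  ... | yes (b , m₀b≢0) =
        relabel-smallFort G π (contract-smallFort G′ m₀₁≢0 m₀b≢0 rest≡0 (ih (contract G′)))
    where
    -- Fixes `0F` and `1F`, and swaps `2F` with `suc (suc b)`.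
    π : Permutation′ (3 + n)
    π = lift₀ (lift₀ (transpose 0F b))

    G′ = relabel G π

    -- Two nonzero multiplicities already exhaust a degree of at most two.
    rest≤0 : ∀ a b r → a ≢ 0 → b ≢ 0 → a + (b + r) ≤ 2 → r ≤ 0
    rest≤0 zero    b       r a≢0 b≢0 le = contradiction refl a≢0
    rest≤0 (suc a) zero    r a≢0 b≢0 le = contradiction refl b≢0
    rest≤0 (suc a) (suc b) r a≢0 b≢0 le = s≤s⁻¹ (≤-trans (s≤s (m≤n+m r b))
      (≤-trans (m≤n+m _ a) (s≤s⁻¹ le)))

    rest≡0 : ∀ j → mult G′ 0F (suc (suc (suc j))) ≡ 0
    rest≡0 j = n≤0⇒n≡0 (≤-trans
      (term≤sum (λ j → mult G′ 0F (suc (suc (suc j)))) j)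
      (rest≤0 (mult G 0F 1F) _ _ m₀₁≢0 m₀b≢0
        (≤-trans (m≤n+m _ (mult G 0F 0F))
          (≤-trans (≤-reflexive (degree-relabel G π 0F)) deg≤2))))

  degree≤2-smallFort : (G : Multigraph (3 + n)) → degree G 0F ≤ 2 → SmallFort G
  degree≤2-smallFort G deg≤2 with any? (λ j → ¬? (mult G 0F (suc j) ≟ 0))
  ... | no ¬p = isolated-smallFort G λ j → decidable-stable (_ ≟ 0) λ m≢0 → ¬p (j , m≢0)
  ... | yes (a , m₀a≢0) = relabel-smallFort G π (adjacent-smallFort (relabel G π)
        (≤-trans (≤-reflexive (degree-relabel G π 0F)) deg≤2) m₀a≢0)
    where
    π : Permutation′ (3 + n)
    π = lift₀ (transpose 0F a)

-- Maximum cuts and the case of minimum degree three.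

argmax : ∀ n (f : (Fin n → Bool) → ℕ) → (∀ {W W′} → W ≗ W′ → f W ≡ f W′) →
         ∃ λ W → ∀ W′ → f W′ ≤ f W
argmax zero    f f-cong = (λ ()) , λ W′ → ≤-reflexive (f-cong λ ())
argmax (suc n) f f-cong = better (best true) (best false)
  where
  ∷-cong : ∀ b {W W′ : Fin n → Bool} → W ≗ W′ → b ∷ W ≗ b ∷ W′
  ∷-cong b W≗W′ zero    = refl
  ∷-cong b W≗W′ (suc i) = W≗W′ i

  -- A Boolean function is recovered from its head and tail only pointwise; `f-cong` carries the
  -- value of `f` across.
  η : ∀ {b} (W : Fin (suc n) → Bool) → head W ≡ b → W ≗ b ∷ tail W
  η W eq zero    = eq
  η W eq (suc i) = refl

  Best : Bool → Set
  Best b = ∃ λ W → ∀ W′ → f (b ∷ W′) ≤ f (b ∷ W)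

  best : ∀ b → Best b
  best b = argmax n (f ∘ (b ∷_)) (f-cong ∘ ∷-cong b)

  bound : ∀ {x y} → (∀ W′ → f (true ∷ W′) ≤ x) → (∀ W′ → f (false ∷ W′) ≤ y) →
          ∀ {z} → x ≤ z → y ≤ z → ∀ W′ → f W′ ≤ z
  bound ≤x ≤y x≤z y≤z W′ with head W′ in eq
  ... | true  = ≤-trans (≤-reflexive (f-cong (η W′ eq))) (≤-trans (≤x (tail W′)) x≤z)
  ... | false = ≤-trans (≤-reflexive (f-cong (η W′ eq))) (≤-trans (≤y (tail W′)) y≤z)

  better : Best true → Best false → ∃ λ W → ∀ W′ → f W′ ≤ f W
  better (T , T-max) (F , F-max) with ≤-total (f (true ∷ T)) (f (false ∷ F))
  ... | inj₁ T≤F = false ∷ F , bound T-max F-max T≤F ≤-refl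
  ... | inj₂ F≤T = true ∷ T , bound T-max F-max ≤-refl F≤T

module _ {n} (G : Multigraph n) where

  crossing : (Fin n → Bool) → Fin n → ℕ
  crossing W v = sum (λ w → mult G v w when (W v xor W w))

  -- Every crossing edge is counted from both ends.
  cut : (Fin n → Bool) → ℕ
  cut W = sum (crossing W)

  cut-cong : ∀ {W W′} → W ≗ W′ → cut W ≡ cut W′
  cut-cong W≗W′ = sum-cong-≗ λ v → sum-cong-≗ λ w →
    cong₂ (λ b c → mult G v w when (b xor c)) (W≗W′ v) (W≗W′ w)

module _ {n} (G : Multigraph (suc n)) (v : Fin (suc n)) where

  -- The side `b` of `v` is kept apart from the sides `V` of the other vertices, so that `v` can be
  -- flipped alone.
  starCut : Bool → (Fin n → Bool) → ℕ
  starCut b V = sum (λ j → mult G v (punchIn v j) when (b xor V j))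

  cutWithout : (Fin n → Bool) → ℕ
  cutWithout V = sum (λ i → sum (λ j → mult G (punchIn v i) (punchIn v j) when (V i xor V j)))

  crossing-split : ∀ W → crossing G W v ≡ starCut (W v) (removeAt W v)
  crossing-split W = begin
    crossing G W v
      ≡⟨ sum-remove {i = v} (λ w → mult G v w when (W v xor W w)) ⟩
    mult G v v when (W v xor W v) + starCut (W v) (removeAt W v)
      ≡⟨ cong (_+ starCut (W v) (removeAt W v))
           (trans (cong (_when (W v xor W v)) (loopless G v)) (0-when (W v xor W v))) ⟩
    starCut (W v) (removeAt W v) ∎
    where open ≡-Reasoning

  -- The star appears twice because `cut` counts each crossing edge at `v` from both ends.
  cut-split : ∀ W → cut G W ≡
    starCut (W v) (removeAt W v) + (starCut (W v) (removeAt W v) + cutWithout (removeAt W v))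
  cut-split W = begin
    cut G W
      ≡⟨ sum-remove {i = v} (crossing G W) ⟩
    crossing G W v + sum (λ i → crossing G W (punchIn v i))
      ≡⟨ cong₂ _+_ (crossing-split W) (sum-cong-≗ λ i →
           sum-remove {i = v} (λ w → mult G (punchIn v i) w when (W (punchIn v i) xor W w))) ⟩
    star + sum (λ i → toV i + rest i)
      ≡⟨ cong (star +_) (∑-distrib-+ toV rest) ⟩
    star + (sum toV + cutWithout V)
      ≡⟨ cong (λ x → star + (x + cutWithout V)) (sum-cong-≗ λ i →
           cong₂ _when_ (symmetric G (punchIn v i) v) (xor-comm (V i) (W v))) ⟩
    star + (star + cutWithout V) ∎
    where
    open ≡-Reasoning
    V = removeAt W v
    star = starCut (W v) V
    toV rest : Fin n → ℕ
    toV i = mult G (punchIn v i) v when (V i xor W v)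
    rest i = sum (λ j → mult G (punchIn v i) (punchIn v j) when (V i xor V j))

  -- Each edge at `v` crosses for exactly one of the two sides that `v` may take.
  starCut-not : ∀ b V → starCut b V + starCut (not b) V ≡ degree G v
  starCut-not b V = begin
    starCut b V + starCut (not b) V
      ≡⟨ ∑-distrib-+ (λ j → mult G v (punchIn v j) when (b xor V j)) _ ⟨
    sum (λ j → mult G v (punchIn v j) when (b xor V j) + mult G v (punchIn v j) when (not b xor V j))
      ≡⟨ sum-cong-≗ (λ j → when-xor-not (mult G v (punchIn v j)) b (V j)) ⟩
    sum (λ j → mult G v (punchIn v j))
      ≡⟨ cong (_+ sum (λ j → mult G v (punchIn v j))) (loopless G v) ⟨
    mult G v v + sum (λ j → mult G v (punchIn v j))
      ≡⟨ sum-remove {i = v} (mult G v) ⟨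
    degree G v ∎
    where open ≡-Reasoning

  cut-flip : ∀ W → let V = removeAt W v; b = not (W v) in
    cut G (insertAt V v b) ≡ starCut b V + (starCut b V + cutWithout V)
  cut-flip W = trans (cut-split W′) (cong₂ _+_ star≡ (cong₂ _+_ star≡ rest≡))
    where
    V = removeAt W v
    W′ = insertAt V v (not (W v))

    V≡ : removeAt W′ v ≗ V
    V≡ = insertAt-punchIn V v (not (W v))

    star≡ : starCut (W′ v) (removeAt W′ v) ≡ starCut (not (W v)) V
    star≡ = sum-cong-≗ λ j → cong₂ (λ b c → mult G v (punchIn v j) when (b xor c))
      (insertAt-lookup V v (not (W v))) (V≡ j)

    rest≡ : cutWithout (removeAt W′ v) ≡ cutWithout V
    rest≡ = sum-cong-≗ λ i → sum-cong-≗ λ j →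
      cong₂ (λ b c → mult G (punchIn v i) (punchIn v j) when (b xor c)) (V≡ i) (V≡ j)

  -- Flipping `v` changes only the star terms, so maximality makes the crossing edges at `v` at
  -- least half of its degree, and half of three rounds up to two.
  maxCut-crossing : ∀ W → (∀ W′ → cut G W′ ≤ cut G W) → 3 ≤ degree G v → 2 ≤ crossing G W v
  maxCut-crossing W W-max 3≤deg = subst (2 ≤_) (≡-sym (crossing-split W)) (halve
    (+-double-≤ (subst₂ _≤_ (cut-flip W) (cut-split W)
      (W-max (insertAt (removeAt W v) v (not (W v))))))
    (subst (3 ≤_) (≡-sym (starCut-not (W v) (removeAt W v))) 3≤deg))
    where
    +-double-≤ : ∀ {x y r} → x + (x + r) ≤ y + (y + r) → x ≤ y
    +-double-≤ {x} {y} {r} le with x ≤? y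
    ... | yes x≤y = x≤y
    ... | no  x≰y = contradiction
          (≤-trans (+-mono-≤ (≰⇒> x≰y) (+-monoˡ-≤ r (<⇒≤ (≰⇒> x≰y)))) le) (<-irrefl refl)

    halve : ∀ {x y} → y ≤ x → 3 ≤ x + y → 2 ≤ x
    halve {zero}        z≤n       ()
    halve {suc zero}    z≤n       (s≤s ())
    halve {suc zero}    (s≤s z≤n) (s≤s (s≤s ()))
    halve {suc (suc x)} _         _ = s≤s (s≤s z≤n)

-- From a vertex outside `W`, the crossing edges are exactly the edges into `W`. Nonemptiness
-- follows because a crossing edge at `0F` has an end in `W`.
crossing-fort : ∀ {n} (G : Multigraph (suc n)) W → (∀ v → 2 ≤ crossing G W v) → Fort G W
crossing-fort G W 2≤crossing = nonempty , fort
  where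
  xor-true : ∀ {x} b c → x when (b xor c) ≢ 0 → b ≡ true ⊎ c ≡ true
  xor-true true  _     _   = inj₁ refl
  xor-true false true  _   = inj₂ refl
  xor-true false false 0≢0 = contradiction refl 0≢0

  nonempty : ∃ λ v → W v ≡ true
  nonempty with sum≢0⇒∃ (λ w → mult G 0F w when (W 0F xor W w))
                  (λ sum≡0 → contradiction (subst (2 ≤_) sum≡0 (2≤crossing 0F)) λ ())
  ... | w , mw≢0 with xor-true (W 0F) (W w) mw≢0
  ...   | inj₁ W0 = 0F , W0
  ...   | inj₂ Ww = w , Ww

  fort : ∀ v → W v ≡ false → edgesInto G W v ≢ 1
  fort v Wv eq = contradiction (subst (2 ≤_) (trans crossing≡ eq) (2≤crossing v)) λ { (s≤s ()) }
    where
    crossing≡ : crossing G W v ≡ edgesInto G W v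
    crossing≡ = sum-cong-≗ λ w → cong (λ b → mult G v w when (b xor W w)) Wv

size-complement : ∀ {n} (W : Fin n → Bool) → size W + size (not ∘ W) ≡ n
size-complement {zero}  W = refl
size-complement {suc n} W with W 0F
... | true  = cong suc (size-complement (tail W))
... | false = trans (+-suc (size (tail W)) _) (cong suc (size-complement (tail W)))

degree≥3-smallFort : ∀ {n} (G : Multigraph (suc n)) → (∀ v → 3 ≤ degree G v) → SmallFort G
degree≥3-smallFort {n} G 3≤deg with argmax (suc n) (cut G) (cut-cong G)
... | W , W-max = smallerSide (≤-total (size W) (size (not ∘ W)))
  where
  2≤crossing : ∀ v → 2 ≤ crossing G W v
  2≤crossing v = maxCut-crossing G v W W-max (3≤deg v)

  -- Complementing both ends of an edge does not change whether it crosses.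
  2≤crossing-not : ∀ v → 2 ≤ crossing G (not ∘ W) v
  2≤crossing-not v = subst (2 ≤_)
    (sum-cong-≗ λ w → cong (mult G v w when_) (≡-sym (xor-annihilates-not (W v) (W w))))
    (2≤crossing v)

  small : ∀ {s t} → s ≤ t → s + t ≡ suc n → s + s ≤ 3 + n
  small {s} s≤t s+t≡ = ≤-trans (+-monoʳ-≤ s s≤t)
    (≤-trans (≤-reflexive s+t≡) (m≤n+m (suc n) 2))

  smallerSide : _ → SmallFort G
  smallerSide (inj₁ W≤) = W , crossing-fort G W 2≤crossing , small W≤ (size-complement W)
  smallerSide (inj₂ ≤W) = not ∘ W , crossing-fort G (not ∘ W) 2≤crossing-not ,
    small ≤W (trans (+-comm (size (not ∘ W)) _) (size-complement W))

-- The induction on the number of vertices.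

smallFort : ∀ n (G : Multigraph (suc n)) → SmallFort G
smallFort zero          G = full-smallFort G (s≤s z≤n)
smallFort (suc zero)    G = full-smallFort G (s≤s (s≤s z≤n))
smallFort (suc (suc n)) G with any? (λ v → degree G v ≤? 2)
... | no ¬p = degree≥3-smallFort G λ v → ≰⇒> λ deg≤2 → ¬p (v , deg≤2)
-- The recursive call provides forts for `suc n` vertices, two fewer than the present `3 + n`.
... | yes (v , deg≤2) = relabel-smallFort G π (degree≤2-smallFort (smallFort n) (relabel G π)
        (≤-trans (≤-reflexive (degree-relabel G π 0F)) deg≤2))
  where
  π : Permutation′ (3 + n)
  π = transpose 0F v

-- From forts to failed zero forcing sets.

toMultigraph : ∀ {n} → Graph n → Multigraph n
toMultigraph {n} G = record { mult = m ; symmetric = m-sym ; loopless = m-loopless }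
  where
  m : Fin n → Fin n → ℕ
  m u v = 1 when does (adj? G u v)

  m-sym : ∀ u v → m u v ≡ m v u
  m-sym u v with adj? G u v | adj? G v u
  ... | yes _  | yes _  = refl
  ... | no _   | no _   = refl
  ... | yes uv | no ¬vu = contradiction (sym G uv) ¬vu
  ... | no ¬uv | yes vu = contradiction (sym G vu) ¬uv

  m-loopless : ∀ v → m v v ≡ 0
  m-loopless v with adj? G v v
  ... | yes vv = contradiction vv (irrefl G)
  ... | no _   = refl

-- Translates the color change rule: when `u` forces `v` and all filled vertices avoid `W`, a `v` in
-- `W` would be the one edge from `u` into `W`, which a fort forbids.
single-neighbour : ∀ {n} (G : Graph n) W {u v} → Adj G u v → W v ≡ true →
  (∀ w → Adj G u w → w ≢ v → W w ≡ false) → edgesInto (toMultigraph G) W u ≡ 1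
single-neighbour {suc n} G W {u} {v} uv Wv others = trans
  (sum-remove {i = v} (λ w → 1 when does (adj? G u w) when W w))
  (cong₂ _+_ at-v (sum-zero elsewhere))
  where
  at-v : 1 when does (adj? G u v) when W v ≡ 1
  at-v rewrite Wv | dec-true (adj? G u v) uv = refl

  elsewhere : ∀ j → 1 when does (adj? G u (punchIn v j)) when W (punchIn v j) ≡ 0
  elsewhere j with adj? G u (punchIn v j)
  ... | yes uw rewrite others (punchIn v j) uw (punchInᵢ≢i v j) = refl
  ... | no _ = 0-when (W (punchIn v j))

-- Induction on the derivation: a vertex of `W` would have to be forced by some `u` outside `W`
-- whose other neighbours all lie outside `W`.
derived-avoids-fort : ∀ {n} (G : Graph n) W → Fort (toMultigraph G) W →
  ∀ {v} → Derived G (tabulate (not ∘ W)) v → W v ≡ false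
derived-avoids-fort G W F {v} (initial v∈S) =
  ¬-not λ Wv → contradiction
    (trans (cong not (≡-sym Wv)) (trans (≡-sym (lookup∘tabulate (not ∘ W) v)) ([]=⇒lookup v∈S)))
    λ ()
derived-avoids-fort G W F@(_ , fort) {v} (force {u} du uv others) =
  ¬-not λ Wv → fort u (derived-avoids-fort G W F du)
    (single-neighbour G W uv Wv λ w uw w≢v → derived-avoids-fort G W F (others w uw w≢v))

∣tabulate∣ : ∀ {n} (W : Fin n → Bool) → ∣ tabulate W ∣ ≡ size W
∣tabulate∣ {zero}  W = refl
∣tabulate∣ {suc n} W with W 0F
... | true  = cong suc (∣tabulate∣ (tail W))
... | false = ∣tabulate∣ (tail W)

-- Eliminating `s` gives `n ≤ 2t + 1`, hence `n < 2(t + 1)`, which bounds the rounded-down half of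
-- `n` by `t`.
half-complement : ∀ {s t n} → s + t ≡ suc n → s + s ≤ 3 + n → n / 2 ≤ t
half-complement {s} {t} {n} s+t≡ small = s≤s⁻¹ (m<n*o⇒m/o<n {n} {suc t} {2}
  -- Adding `3 + n` to both sides avoids subtraction.
  (+-cancelʳ-≤ (3 + n) (suc n) (suc t * 2) (begin
    suc n + (3 + n)                ≡⟨ rearrange₁ n ⟩
    2 + (suc n + suc n)            ≡⟨ cong (λ x → 2 + (x + x)) s+t≡ ⟨
    2 + ((s + t) + (s + t))        ≡⟨ rearrange₂ s t ⟩
    suc t * 2 + (s + s)            ≤⟨ +-monoʳ-≤ (suc t * 2) small ⟩
    suc t * 2 + (3 + n)            ∎)))
  where
  open ≤-Reasoning
  rearrange₁ : ∀ n → suc n + (3 + n) ≡ 2 + (suc n + suc n)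
  rearrange₁ = solve-∀
  rearrange₂ : ∀ s t → 2 + ((s + t) + (s + t)) ≡ suc t * 2 + (s + s)
  rearrange₂ = solve-∀

theorem2 : (n : ℕ) → (G : Graph (suc n)) → ((suc n ∸ 1) / 2) ≤F G
theorem2 n G with smallFort n (toMultigraph G)
... | W , F@((v , Wv) , _) , small =
  -- The failed set is the complement of the fort, and the vertex `v` of the fort is never filled.
  tabulate (not ∘ W) ,
  (v , λ dv → contradiction (trans (≡-sym Wv) (derived-avoids-fort G W F dv)) λ ()) ,
  subst (n / 2 ≤_) (≡-sym (∣tabulate∣ (not ∘ W)))
    (half-complement {size W} (size-complement W) small)
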